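{- Consider an instance of the weighted popular matching problem with strict preference lists, in which every applicant has a last resort job. If $M$ is a popular matching, then $M$ is well-formed; that is, for every $i$, every $f_i$-job $p$ is matched in $M$ to an applicant $x\in C_i$ with $f(x)=p$, and every applicant $x\in A$ is matched in $M$ either to $f(x)$ or to $s(x)$.
   Context: Instance. A finite bipartite graph $H=(A,J,E)$ between applicants $A$ and jobs $J$; each edge $(x,p)$ has a rank $r_x(p)\in\mathbb{Z}^+$; each applicant $x$ has a weight $w(x)>0$. The jobs adjacent to $x$ form $x$'s preference list (not necessarily containing all jobs). Applicant $x$ prefers $p$ over $q$ if $r_x(p)<r_x(q)$. Lists are strict: the jobs on $x$'s list have distinct ranks for $x$. Every applicant $x$ has a last resort job $l(x)$, which is on the list of no other applicant and is the last job on $x$'s list. Being unmatched is worse for $x$ than receiving any job on $x$'s list. Popularity. The satisfaction of a matching $M_1$ with respect to $M_2$ is the total weight of applicants who prefer (the job they get in) $M_1$ over $M_2$ minus the total weight of those who prefer $M_2$ over $M_1$. $M_1$ is more popular than $M_2$ if this is positive. $M$ is popular if no matching of $H$ is more popular than $M$. Categories. $A$ is partitioned into nonempty sets $C_1,\dots,C_k$, where applicants in $C_i$ have weight $w_i$ and $w_1>w_2>\dots>w_k>0$. First and second jobs. For $x\in C_1$, $f(x)$ is the first job on $x$'s list; such jobs are called $f_1$-jobs. Inductively, for $x\in C_i$ with $i>1$, $f(x)$ is the first job on $x$'s list that is not an $f_j$-job for any $j<i$; the jobs $f(x)$, $x\in C_i$, are the $f_i$-jobs. For $x\in C_i$, $s(x)$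 is the first job on $x$'s list that is not an $f_j$-job for any $j\le i$; $s(x)$ is undefined exactly when $f(x)=l(x)$, in which case "matched to $f(x)$ or $s(x)$" means matched to $f(x)$. -}

module Defs where

open import Algebra.Bundles using (AbelianGroup)
open import Data.Bool.Base using (if_then_else_)
open import Data.Empty using (⊥)
open import Data.Fin.Base as Fin using (Fin; toℕ)
open import Data.Fin.Subset using (Subset; _∈_)
open import Data.Maybe.Base using (Maybe; just; nothing)
open import Data.Nat.Base as ℕ using (ℕ; zero; suc)
import Data.Nat.Properties as ℕ
open import Data.Product using (∃; _×_; _,_)
open import Data.Sum.Base using (_⊎_; inj₁; inj₂)
open import Function.Bundles using (_⇔_; mk⇔)
open import Level as Level using (Level; _⊔_)
open import Relation.Binary.Core using (Rel)
open import Relation.Binary.Definitions using (Decidable)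
open import Relation.Binary.PropositionalEquality using (_≡_; refl)
open import Relation.Binary.Structures using (IsStrictTotalOrder)
open import Relation.Nullary using (¬_; yes; no; does)
open import Relation.Nullary.Decidable using (map′)
import Algebra.Definitions.RawMonoid as RawMonoidDefs

private
  variable
    c ℓ₁ ℓ₂ : Level

-- Weights are only added, subtracted and compared, so they may live in any
-- linearly ordered abelian group; (ℝ, +, <) is the motivating example.
record OrderedAbelianGroup c ℓ₁ ℓ₂ : Set (Level.suc (c ⊔ ℓ₁ ⊔ ℓ₂)) where
  infix 4 _<_
  field
    abelianGroup : AbelianGroup c ℓ₁

  open AbelianGroup abelianGroup public
    renaming (_∙_ to _+_; ε to 0#; _⁻¹ to -_)

  field
    _<_                : Rel Carrier ℓ₂
    isStrictTotalOrder : IsStrictTotalOrder _≈_ _<_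
    +-monoˡ-<          : ∀ z {x y} → x < y → (x + z) < (y + z)

  open RawMonoidDefs rawMonoid public using (sum)

record Instance (W : OrderedAbelianGroup c ℓ₁ ℓ₂) : Set (c ⊔ ℓ₂) where
  open OrderedAbelianGroup W using (Carrier; 0#; _<_)
  field
    #applicants #jobs : ℕ

  Applicant : Set
  Applicant = Fin #applicants

  Job : Set
  Job = Fin #jobs

  field
    list       : Applicant → Subset #jobs
    -- Meaningful only on edges: the value of rank x p is irrelevant when p ∉ list x.
    rank       : Applicant → Job → ℕ
    rank-pos   : ∀ {x p} → p ∈ list x → 0 ℕ.< rank x p
    weight     : Applicant → Carrier
    weight-pos : ∀ x → 0# < weight x

module _ {W : OrderedAbelianGroup c ℓ₁ ℓ₂} (H : Instance W) where
  private module W = OrderedAbelianGroup W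
  open Instance H

  Strict : Set
  Strict = ∀ {x p q} → p ∈ list x → q ∈ list x → rank x p ≡ rank x q → p ≡ q

  record LastResorts : Set where
    field
      l           : Applicant → Job
      l-on-list   : ∀ x → l x ∈ list x
      l-exclusive : ∀ {x y} → l x ∈ list y → y ≡ x
      l-last      : ∀ {x p} → p ∈ list x → rank x p ℕ.≤ rank x (l x)

  record Matching : Set where
    field
      partner   : Applicant → Maybe Job
      on-list   : ∀ {x p} → partner x ≡ just p → p ∈ list x
      injective : ∀ {x y p} → partner x ≡ just p → partner y ≡ just p → x ≡ y

  open Matching

  data Prefers (x : Applicant) : Rel (Maybe Job) Level.zero where
    better-rank    : ∀ {p q} → rank x p ℕ.< rank x q → Prefers x (just p) (just q)
    over-unmatched : ∀ {p} → Prefers x (just p) nothing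

  prefers? : ∀ x → Decidable (Prefers x)
  prefers? x (just p) (just q) =
    map′ better-rank (λ { (better-rank r) → r }) (rank x p ℕ.<? rank x q)
  prefers? x (just p) nothing  = yes over-unmatched
  prefers? x nothing  _        = no λ ()

  weightPreferring : Matching → Matching → W.Carrier
  weightPreferring M₁ M₂ = W.sum λ x →
    if does (prefers? x (partner M₁ x) (partner M₂ x)) then weight x else W.0#

  satisfaction : Matching → Matching → W.Carrier
  satisfaction M₁ M₂ = weightPreferring M₁ M₂ W.+ (W.- weightPreferring M₂ M₁)

  MorePopular : Matching → Matching → Set ℓ₂
  MorePopular M₁ M₂ = W.0# W.< satisfaction M₁ M₂

  Popular : Matching → Set ℓ₂
  Popular M = ¬ (∃ λ M′ → MorePopular M′ M)

  record Categories : Set (c ⊔ ℓ₁ ⊔ ℓ₂) where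
    field
      k               : ℕ
      category        : Applicant → Fin k
      nonempty        : ∀ i → ∃ λ x → category x ≡ i
      category-weight : Fin k → W.Carrier
      weight≈         : ∀ x → weight x W.≈ category-weight (category x)
      decreasing      : ∀ {i j} → i Fin.< j → category-weight j W.< category-weight i

  -- p is the first job on x's list among those satisfying P.
  IsFirst : Applicant → (Job → Set) → Job → Set
  IsFirst x P p = p ∈ list x × P p × (∀ q → q ∈ list x → P q → rank x p ℕ.≤ rank x q)

  module _ (C : Categories) where
    open Categories C

    -- p is an f_j-job for some category j with toℕ j < t (see FJobBelow⇔).
    FJobBelow : ℕ → Job → Set
    FJobBelow zero    p = ⊥
    FJobBelow (suc t) p = FJobBelow t p ⊎
      (∃ λ x → toℕ (category x) ≡ t × IsFirst x (λ q → ¬ FJobBelow t q) p)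

    -- f(x) = p
    IsF : Applicant → Job → Set
    IsF x = IsFirst x (λ q → ¬ FJobBelow (toℕ (category x)) q)

    FJob : Fin k → Job → Set
    FJob i p = ∃ λ x → category x ≡ i × IsF x p

    FJobBelow⇔ : ∀ t p → FJobBelow t p ⇔ (∃ λ j → toℕ j ℕ.< t × FJob j p)
    FJobBelow⇔ t p = mk⇔ (to t) (λ { (j , j<t , fj) → from t j<t fj })
      where
      to : ∀ t → FJobBelow t p → ∃ λ j → toℕ j ℕ.< t × FJob j p
      to (suc t) (inj₁ b) with to t b
      ... | j , j<t , fj = j , ℕ.m<n⇒m<1+n j<t , fj
      to (suc t) (inj₂ (x , refl , first)) =
        category x , ℕ.n<1+n _ , x , refl , first

      from : ∀ t {j} → toℕ j ℕ.< t → FJob j p → FJobBelow t p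
      from (suc t) j<1+t fj with ℕ.m<1+n⇒m<n∨m≡n j<1+t
      from (suc t) _ fj                 | inj₁ j<t  = inj₁ (from t j<t fj)
      from (suc t) _ (x , refl , first) | inj₂ refl = inj₂ (x , refl , first)

    -- s(x) = p; no such p exists when s(x) is undefined.
    IsS : Applicant → Job → Set
    IsS x = IsFirst x (λ q → ∀ j → j Fin.≤ category x → ¬ FJob j q)

    WellFormed : Matching → Set
    WellFormed M =
      (∀ i p → FJob i p →
         ∃ λ x → category x ≡ i × IsF x p × partner M x ≡ just p)
      × (∀ x → ∃ λ p → (IsF x p ⊎ IsS x p) × partner M x ≡ just p)

{-# OPTIONS --safe #-}

-- A popular matching admits no profitable local reassignment, and two of them
-- suffice.  Giving x a job p it prefers, held by nobody or by someone lighter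
-- than x, is profitable.  So is giving x such a p whatever its holder y
-- weighs, provided that y can in turn be given a job it prefers to p whose
-- holder z is no heavier than y: the gain of y pays for z, and that of x remains.
--
-- If y holds a job p ≠ f(y) that is not an f_j-job for any category j before
-- that of y, then y prefers f(y), so nobody prefers p to what they have unless
-- f(y) is held by someone heavier than y.  By induction on the category i this
-- forces every f_i-job to be held by some x in C_i with f(x) = p: first the
-- holder cannot come from an earlier category, then it must be in C_i, then it
-- must have p as its first job.  The same exchange forces s(x) on every x that
-- does not hold f(x).
module Submission where

open import Defs
open import Data.Bool.Base using (if_then_else_)
open import Data.Empty using (⊥-elim)
open import Data.Fin.Base as Fin using (Fin; zero; suc; toℕ; punchIn; punchOut)
open import Data.Fin.Induction using (<-wellFounded)
import Data.Fin.Properties as Fin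
open import Data.Fin.Subset using (_∈_)
open import Data.Fin.Subset.Properties using (_∈?_)
open import Data.Maybe.Base using (Maybe; just; nothing)
import Data.Maybe.Properties as Maybe
import Data.Nat.Base as ℕ
import Data.Nat.Induction as ℕ
import Data.Nat.Properties as ℕ
open import Data.Product using (∃; _×_; _,_; proj₁; proj₂)
open import Data.Sum.Base as Sum using (_⊎_; inj₁; inj₂; [_,_]′)
open import Data.Vec.Functional using (removeAt)
open import Data.Vec.Functional.Properties using (removeAt-punchOut)
open import Function.Base using (_∘_)
open import Function.Bundles using (Equivalence)
open import Induction.WellFounded using (Acc; acc; module All)
open import Level using (Level)
open import Relation.Binary.Definitions using (tri<; tri≈; tri>)
open import Relation.Binary.PropositionalEquality as ≡
  using (_≡_; _≢_; refl; sym; trans; cong; subst)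
open import Relation.Binary.Structures using (IsStrictTotalOrder)
open import Relation.Nullary using (¬_; Dec; yes; no; does)
open import Relation.Nullary.Decidable
  using (dec-true; dec-false; _×-dec_; _→-dec_; _⊎-dec_; ¬?)
open import Relation.Nullary.Negation using (contradiction)
open import Relation.Unary using (Decidable)
import Algebra.Properties.CommutativeMonoid.Sum as CommutativeMonoidSum
import Relation.Binary.Construct.StrictToNonStrict as StrictToNonStrict

private
  variable
    c ℓ₁ ℓ₂ : Level

-- Finite sums in a linearly ordered abelian group.

module OrderedAbelianGroupProperties (W : OrderedAbelianGroup c ℓ₁ ℓ₂) where
  open OrderedAbelianGroup W
    renaming (refl to ≈-refl; sym to ≈-sym; trans to ≈-trans)
  open IsStrictTotalOrder isStrictTotalOrder public
    using (<-respˡ-≈; <-respʳ-≈) renaming (trans to <-trans)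
  open IsStrictTotalOrder isStrictTotalOrder using (<-resp-≈)
  private module Σ = CommutativeMonoidSum commutativeMonoid
  open StrictToNonStrict _≈_ _<_ public using (_≤_; <⇒≤)
  private module NonStrict = StrictToNonStrict _≈_ _<_

  ≤-refl : ∀ {x} → x ≤ x
  ≤-refl = inj₂ ≈-refl

  ≤-trans : ∀ {x y z} → x ≤ y → y ≤ z → x ≤ z
  ≤-trans = NonStrict.trans isEquivalence <-resp-≈ <-trans

  ≤-<-trans : ∀ {x y z} → x ≤ y → y < z → x < z
  ≤-<-trans = NonStrict.≤-<-trans ≈-sym <-trans <-respˡ-≈

  <-≤-trans : ∀ {x y z} → x < y → y ≤ z → x < z
  <-≤-trans = NonStrict.<-≤-trans <-trans <-respʳ-≈

  +-monoʳ-< : ∀ z {x y} → x < y → (z + x) < (z + y)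
  +-monoʳ-< z x<y = <-respˡ-≈ (comm _ z) (<-respʳ-≈ (comm _ z) (+-monoˡ-< z x<y))

  +-monoʳ-≤ : ∀ z {x y} → x ≤ y → (z + x) ≤ (z + y)
  +-monoʳ-≤ z = Sum.map (+-monoʳ-< z) ∙-congˡ

  x≤x+y : ∀ x {y} → 0# ≤ y → x ≤ (x + y)
  x≤x+y x 0≤y = ≤-trans (inj₂ (≈-sym (identityʳ x))) (+-monoʳ-≤ x 0≤y)

  y<x+y : ∀ y {x} → 0# < x → y < (x + y)
  y<x+y y 0<x = <-respˡ-≈ (identityˡ y) (+-monoˡ-< y 0<x)

  0<y-x : ∀ {x y} → x < y → 0# < (y + (- x))
  0<y-x {x} x<y = <-respˡ-≈ (inverseʳ x) (+-monoˡ-< (- x) x<y)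

  sum-nonNegative : ∀ {n} (f : Fin n → Carrier) → (∀ i → 0# ≤ f i) → 0# ≤ sum f
  sum-nonNegative {ℕ.zero}  f f≥0 = ≤-refl
  sum-nonNegative {ℕ.suc n} f f≥0 =
    ≤-trans (f≥0 zero) (x≤x+y (f zero) (sum-nonNegative (f ∘ suc) (f≥0 ∘ suc)))

  term≤sum : ∀ {n} (f : Fin n → Carrier) → (∀ i → 0# ≤ f i) → ∀ i → f i ≤ sum f
  term≤sum {ℕ.suc n} f f≥0 i =
    ≤-trans (x≤x+y (f i) (sum-nonNegative (removeAt f i) (f≥0 ∘ punchIn i)))
            (inj₂ (≈-sym (Σ.sum-remove f)))

  twoTerms≤sum : ∀ {n} (f : Fin n → Carrier) → (∀ i → 0# ≤ f i) →
                 ∀ {i j} → i ≢ j → (f i + f j) ≤ sum f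
  twoTerms≤sum {ℕ.suc n} f f≥0 {i} {j} i≢j =
    ≤-trans (+-monoʳ-≤ (f i)
               (subst (_≤ sum (removeAt f i)) (removeAt-punchOut f i≢j)
                 (term≤sum (removeAt f i) (f≥0 ∘ punchIn i) (punchOut i≢j))))
            (inj₂ (≈-sym (Σ.sum-remove f)))

  sum-zero : ∀ {n} (f : Fin n → Carrier) → (∀ i → f i ≈ 0#) → sum f ≈ 0#
  sum-zero {n} f f≈0 = ≈-trans (Σ.sum-cong-≋ f≈0) (Σ.sum-replicate-zero n)

  sum-supportedAt : ∀ {n} (f : Fin n → Carrier) i → (∀ j → j ≢ i → f j ≈ 0#) → sum f ≈ f i
  sum-supportedAt {ℕ.suc n} f i f≈0 =
    ≈-trans (Σ.sum-remove f)
      (≈-trans (∙-congˡ (sum-zero (removeAt f i) (λ j → f≈0 (punchIn i j) (Fin.punchInᵢ≢i i j))))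
        (identityʳ (f i)))

-- Preferences and the weights that decide popularity.

module MatchingProperties {W : OrderedAbelianGroup c ℓ₁ ℓ₂} (H : Instance W) where
  open OrderedAbelianGroup W using (Carrier; _<_; _+_; 0#)
    renaming (sym to ≈-sym; reflexive to ≈-reflexive)
  open OrderedAbelianGroupProperties W
  open Instance H
  open Matching

  Holds : Matching H → Applicant → Job → Set
  Holds M x p = partner M x ≡ just p

  holds? : ∀ M x p → Dec (Holds M x p)
  holds? M x p = Maybe.≡-dec Fin._≟_ (partner M x) (just p)

  Improves : Matching H → Applicant → Job → Set
  Improves M x p = Prefers H x (just p) (partner M x)

  Prefers-irrefl : ∀ {x a} → ¬ Prefers H x a a
  Prefers-irrefl (better-rank r) = ℕ.<-irrefl refl r

  Prefers-asym : ∀ {x a b} → Prefers H x a b → ¬ Prefers H x b a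
  Prefers-asym (better-rank r) (better-rank s) = ℕ.<-asym r s

  holder-does-not-improve : ∀ {M x p} → Holds M x p → ¬ Improves M x p
  holder-does-not-improve {x = x} {p} eq i = Prefers-irrefl {a = just p} (subst (Prefers H x (just p)) eq i)

  module _ (M₁ M₂ : Matching H) where
    private
      term : Applicant → Carrier
      term x = if does (prefers? H x (partner M₁ x) (partner M₂ x)) then weight x else 0#

      prefers : Applicant → Set
      prefers x = Prefers H x (partner M₁ x) (partner M₂ x)

      term-yes : ∀ x → prefers x → term x ≡ weight x
      term-yes x pr = cong (λ b → if b then weight x else 0#) (dec-true (prefers? H x _ _) pr)

      term-no : ∀ x → ¬ prefers x → term x ≡ 0#
      term-no x ¬pr = cong (λ b → if b then weight x else 0#) (dec-false (prefers? H x _ _) ¬pr)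

      term≥0 : ∀ x → 0# ≤ term x
      term≥0 x with prefers? H x (partner M₁ x) (partner M₂ x)
      ... | yes _ = <⇒≤ (weight-pos x)
      ... | no  _ = ≤-refl

    weight≤weightPreferring : ∀ {x} → prefers x → weight x ≤ weightPreferring H M₁ M₂
    weight≤weightPreferring {x} px =
      subst (_≤ weightPreferring H M₁ M₂) (term-yes x px) (term≤sum term term≥0 x)

    weights≤weightPreferring : ∀ {x y} → x ≢ y → prefers x → prefers y →
                               (weight x + weight y) ≤ weightPreferring H M₁ M₂
    weights≤weightPreferring {x} {y} x≢y px py =
      subst (_≤ weightPreferring H M₁ M₂) (≡.cong₂ _+_ (term-yes x px) (term-yes y py)) (twoTerms≤sum term term≥0 x≢y)

    -- With at most one applicant preferring `M₁`, the sum is zero or a single weight; `0# < g`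
    -- settles the first case and the bound on weights the second.
    weightPreferring< : ∀ {g} → 0# < g →
      (∀ {z} → prefers z → weight z < g) →
      (∀ {y z} → prefers y → prefers z → y ≡ z) →
      weightPreferring H M₁ M₂ < g
    weightPreferring< 0<g light unique with Fin.any? (λ z → prefers? H z (partner M₁ z) (partner M₂ z))
    ... | no none = <-respˡ-≈ (≈-sym (sum-zero term (λ z → ≈-reflexive (term-no z (λ pz → none (z , pz)))))) 0<g
    ... | yes (z , pz) = <-respˡ-≈ (≈-sym (sum-supportedAt term z
            (λ y y≢z → ≈-reflexive (term-no y (λ py → y≢z (unique py pz))))))
            (subst (_< _) (sym (term-yes z pz)) (light pz))

  -- The value `g` separates gain from loss: the gain is at least `g`, and the loss, due to one
  -- applicant at most, stays below it.
  morePopular : ∀ {M M′ g} → 0# < g → g ≤ weightPreferring H M′ M →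
    (∀ {z} → Prefers H z (partner M z) (partner M′ z) → weight z < g) →
    (∀ {y z} → Prefers H y (partner M y) (partner M′ y) →
               Prefers H z (partner M z) (partner M′ z) → y ≡ z) →
    MorePopular H M′ M
  morePopular {M} {M′} 0<g g≤ light unique =
    0<y-x (<-≤-trans (weightPreferring< M M′ 0<g light unique) g≤)

  -- Giving one applicant a chosen job.

  module _ (M : Matching H) {x p} (p∈ : p ∈ list x) where
    private
      -- The test against `x` takes precedence, so an `x` already holding `p` keeps it; any other
      -- holder of `p` becomes unmatched.
      partner′ : Applicant → Maybe Job
      partner′ z with z Fin.≟ x | holds? M z p
      ... | yes _ | _     = just p
      ... | no _  | yes _ = nothing
      ... | no _  | no _  = partner M z

      partner′-inv : ∀ {z q} → partner′ z ≡ just q → (z ≡ x × q ≡ p) ⊎ (q ≢ p × Holds M z q)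
      partner′-inv {z} eq with z Fin.≟ x | holds? M z p
      partner′-inv refl | yes z≡x | _ = inj₁ (z≡x , refl)
      partner′-inv ()   | no _ | yes _
      partner′-inv {z} eq | no _ | no ¬h = inj₂ ((λ { refl → ¬h eq }) , eq)

    assign : Matching H
    assign .partner = partner′
    assign .on-list {z} eq with partner′-inv {z} eq
    ... | inj₁ (refl , refl) = p∈
    ... | inj₂ (_ , h)       = on-list M h
    assign .injective {y} {z} eq₁ eq₂ with partner′-inv {y} eq₁ | partner′-inv {z} eq₂
    ... | inj₁ (refl , _)   | inj₁ (refl , _)   = refl
    ... | inj₁ (_ , q≡p)    | inj₂ (q≢p , _)    = contradiction q≡p q≢p
    ... | inj₂ (q≢p , _)    | inj₁ (_ , q≡p)    = contradiction q≡p q≢p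
    ... | inj₂ (_ , h₁)     | inj₂ (_ , h₂)     = injective M h₁ h₂

    assign-holds : Holds assign x p
    assign-holds with x Fin.≟ x
    ... | yes _  = refl
    ... | no x≢x = contradiction refl x≢x

    assign-other : ∀ {z} → z ≢ x → Holds M z p ⊎ partner assign z ≡ partner M z
    assign-other {z} z≢x with z Fin.≟ x | holds? M z p
    ... | yes z≡x | _     = contradiction z≡x z≢x
    ... | no _    | yes h = inj₁ h
    ... | no _    | no _  = inj₂ refl

  -- Exchanges excluded by popularity.

  module _ {M : Matching H} (popular : Popular H M) where

    -- Only a former holder of `p` can lose, and the weight of `x` exceeds that loss. If `p` is
    -- free, the condition on holders is vacuous.
    promote : ∀ {x p} → p ∈ list x → Improves M x p →
              ¬ (∀ {y} → Holds M y p → weight y < weight x)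
    promote {x} {p} p∈ better light = popular (M′ , morePopular {M} {M′} (weight-pos x)
        (weight≤weightPreferring M′ M winner)
        (light ∘ loser)
        (λ py pz → injective M {p = p} (loser py) (loser pz)))
      where
      M′ = assign M p∈

      winner : Prefers H x (partner M′ x) (partner M x)
      winner = subst (λ a → Prefers H x a (partner M x)) (sym (assign-holds M p∈)) better

      loser : ∀ {z} → Prefers H z (partner M z) (partner M′ z) → Holds M z p
      loser {z} worse = [ (λ h → h) , (λ eq → contradiction (unchanged eq) Prefers-irrefl) ]′
        (assign-other M p∈ z≢x)
        where
        z≢x : z ≢ x
        z≢x refl = Prefers-asym winner worse

        unchanged : partner M′ z ≡ partner M z → Prefers H z (partner M z) (partner M z)
        unchanged eq = subst (Prefers H z (partner M z)) eq worse

    -- Moving `y` to `q` first frees `p` for `x`. Only the old holder of `q` can lose, and its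
    -- weight is below the combined gain because `x` has positive weight.
    promote-both : ∀ {x y p q} → p ∈ list x → q ∈ list y →
                   Improves M x p → Holds M y p → Improves M y q →
                   ¬ (∀ {z} → Holds M z q → weight z ≤ weight y)
    promote-both {x} {y} {p} {q} p∈ q∈ x-better y-holds y-better light =
      popular (M′ , morePopular {M} {M′}
        (<-trans (weight-pos y) heavier)
        (weights≤weightPreferring M′ M x≢y winner-x winner-y)
        (λ pz → ≤-<-trans (light (loser pz)) heavier)
        (λ pz pz′ → injective M {p = q} (loser pz) (loser pz′)))
      where
      M₁ = assign M q∈
      M′ = assign M₁ p∈

      heavier : weight y < (weight x + weight y)
      heavier = y<x+y (weight y) (weight-pos x)

      x≢y : x ≢ y
      x≢y refl = holder-does-not-improve {M} y-holds x-better

      p≢q : p ≢ q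
      p≢q refl = holder-does-not-improve {M} y-holds y-better

      y-holds-q : Holds M′ y q
      y-holds-q with assign-other M₁ p∈ (x≢y ∘ sym)
      ... | inj₁ h  = contradiction (Maybe.just-injective (trans (sym h) (assign-holds M q∈))) p≢q
      ... | inj₂ eq = trans eq (assign-holds M q∈)

      winner-x : Prefers H x (partner M′ x) (partner M x)
      winner-x = subst (λ a → Prefers H x a (partner M x)) (sym (assign-holds M₁ p∈)) x-better

      winner-y : Prefers H y (partner M′ y) (partner M y)
      winner-y = subst (λ a → Prefers H y a (partner M y)) (sym y-holds-q) y-better

      loser : ∀ {z} → Prefers H z (partner M z) (partner M′ z) → Holds M z q
      loser {z} worse = [ (λ h → h) , (λ eq → contradiction (unchanged eq) Prefers-irrefl) ]′
        (assign-other M q∈ z≢y)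
        where
        z≢x : z ≢ x
        z≢x refl = Prefers-asym winner-x worse

        z≢y : z ≢ y
        z≢y refl = Prefers-asym winner-y worse

        unchanged : partner M₁ z ≡ partner M z → Prefers H z (partner M z) (partner M z)
        -- A `z` unchanged by the first move but displaced by the second would hold `p` in `M`, as
        -- only `y` does.
        unchanged eq₁ = [ (λ h → contradiction (injective M (trans (sym eq₁) h) y-holds) z≢y)
                        , (λ eq → subst (Prefers H z (partner M z)) (trans eq eq₁) worse) ]′
          (assign-other M₁ p∈ z≢x)

-- First jobs on a preference list.

module FirstJobs {W : OrderedAbelianGroup c ℓ₁ ℓ₂} (H : Instance W) where
  open Instance H
  open Matching
  open MatchingProperties H

  isFirst? : ∀ {P : Job → Set} → Decidable P → ∀ x → Decidable (IsFirst H x P)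
  isFirst? P? x p = p ∈? list x ×-dec P? p ×-dec
    Fin.all? (λ q → q ∈? list x →-dec P? q →-dec rank x p ℕ.≤? rank x q)

  -- Descent on the rank: pass to a smaller-ranked job satisfying `P` until there is none.
  first-exists : ∀ {P : Job → Set} → Decidable P → ∀ {x p} → p ∈ list x → P p → ∃ (IsFirst H x P)
  first-exists {P} P? {x} {p} p∈ Pp = go p∈ Pp (ℕ.<-wellFounded (rank x p))
    where
    go : ∀ {p} → p ∈ list x → P p → Acc ℕ._<_ (rank x p) → ∃ (IsFirst H x P)
    go {p} p∈ Pp (acc rec)
      with Fin.any? (λ q → q ∈? list x ×-dec P? q ×-dec rank x q ℕ.<? rank x p)
    ... | yes (q , q∈ , Pq , q<p) = go q∈ Pq (rec q<p)
    ... | no none = p , p∈ , Pp , λ q q∈ Pq → ℕ.≮⇒≥ (λ q<p → none (q , q∈ , Pq , q<p))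

  -- A held job satisfies `P`, so minimality applies to it, and strictness rules out equal ranks.
  first-improves : Strict H → ∀ M {P x p} → IsFirst H x P p →
                   (∀ {q} → Holds M x q → P q) → ¬ Holds M x p → Improves M x p
  first-improves strict M {P} {x} {p} (p∈ , _ , least) P-held ¬held = go (partner M x) refl
    where
    go : ∀ a → partner M x ≡ a → Prefers H x (just p) a
    go nothing  _  = over-unmatched
    go (just q) eq = better-rank (ℕ.≤∧≢⇒< (least q (on-list M eq) (P-held eq))
      (λ r → ¬held (subst (Holds M x) (sym (strict p∈ (on-list M eq) r)) eq)))

-- The structure of a popular matching.

module PopularMatchings {W : OrderedAbelianGroup c ℓ₁ ℓ₂} (H : Instance W)
  (strict : Strict H) (lastResorts : LastResorts H) (C : Categories H)
  (M : Matching H) (popular : Popular H M) where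
  private module W = OrderedAbelianGroup W
  open OrderedAbelianGroupProperties W using (_≤_; <-respˡ-≈; <-respʳ-≈)
  open Instance H
  open LastResorts lastResorts
  open Categories C
  open Matching M
  open MatchingProperties H
  open FirstJobs H

  weight-decreasing : ∀ {x y} → category x Fin.< category y → weight y W.< weight x
  weight-decreasing x<y =
    <-respˡ-≈ (W.sym (weight≈ _)) (<-respʳ-≈ (W.sym (weight≈ _)) (decreasing x<y))

  weight-antitone : ∀ {x y} → category x Fin.≤ category y → weight y ≤ weight x
  weight-antitone x≤y with ℕ.m≤n⇒m<n∨m≡n x≤y
  ... | inj₁ x<y = inj₁ (weight-decreasing x<y)
  ... | inj₂ x≡y = inj₂ (W.trans (weight≈ _)
    (W.trans (W.reflexive (cong category-weight (sym (Fin.toℕ-injective x≡y)))) (W.sym (weight≈ _))))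

  fJobBelow? : ∀ t → Decidable (FJobBelow H C t)
  fJobBelow? ℕ.zero    p = no λ ()
  fJobBelow? (ℕ.suc t) p = fJobBelow? t p ⊎-dec
    Fin.any? (λ x → toℕ (category x) ℕ.≟ t ×-dec isFirst? (λ q → ¬? (fJobBelow? t q)) x p)

  isF? : ∀ x → Decidable (IsF H C x)
  isF? x = isFirst? (λ q → ¬? (fJobBelow? _ q)) x

  fJob? : ∀ i → Decidable (FJob H C i)
  fJob? i p = Fin.any? (λ x → category x Fin.≟ i ×-dec isF? x p)

  fJobBelow⇒ : ∀ {t p} → FJobBelow H C t p → ∃ λ j → toℕ j ℕ.< t × FJob H C j p
  fJobBelow⇒ = Equivalence.to (FJobBelow⇔ H C _ _)

  fJobBelow⇐ : ∀ {t p j} → toℕ j ℕ.< t → FJob H C j p → FJobBelow H C t p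
  fJobBelow⇐ j<t fj = Equivalence.from (FJobBelow⇔ H C _ _) (_ , j<t , fj)

  -- The search can start at `l x`: only `x` lists it, so no applicant of an earlier category can
  -- have made it an f-job.
  f-exists : ∀ x → ∃ (IsF H C x)
  f-exists x = first-exists (λ q → ¬? (fJobBelow? _ q)) (l-on-list x) l-available
    where
    l-available : ¬ FJobBelow H C (toℕ (category x)) (l x)
    l-available b with fJobBelow⇒ b
    ... | _ , j<x , y , refl , l∈ , _ = ℕ.<-irrefl (cong (toℕ ∘ category) (l-exclusive l∈)) j<x

  -- Since `p` is among the jobs of which `f(y)` is the first, `y` prefers `f(y)`. The double
  -- exchange with `q = f(y)` is then profitable unless `f(y)` is held from an earlier category.
  chain : ∀ {x y p} → p ∈ list x → Improves M x p → Holds M y p →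
          ¬ FJobBelow H C (toℕ (category y)) p → ¬ IsF H C y p →
          ¬ (∀ {q z} → IsF H C y q → Holds M z q → category y Fin.≤ category z)
  chain {y = y} p∈ x-better y-holds p-available p≢f light with f-exists y
  ... | q , isF = promote-both {M = M} popular p∈ (proj₁ isF) x-better y-holds
    (first-improves strict M isF
      (λ h → subst (λ r → ¬ FJobBelow H C (toℕ (category y)) r) (held y-holds h) p-available)
      (λ h → p≢f (subst (IsF H C y) (held h y-holds) isF)))
    (λ h → weight-antitone (light isF h))
    where
    held : ∀ {a b} → Holds M y a → Holds M y b → a ≡ b
    held h₁ h₂ = Maybe.just-injective (trans (sym h₁) h₂)

  FJobsMatched : Fin k → Set
  FJobsMatched i = ∀ p → FJob H C i p → ∃ λ x → category x ≡ i × IsF H C x p × Holds M x p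

  f-holder-category : ∀ {y} → FJobsMatched (category y) →
    ∀ {q z} → IsF H C y q → Holds M z q → category y Fin.≤ category z
  f-holder-category {y} matched isFy hz with matched _ (y , refl , isFy)
  ... | z′ , eq , _ , hz′ with injective hz hz′
  ...   | refl = ℕ.≤-reflexive (cong toℕ (sym eq))

  -- Holders of f-jobs, by induction on the category.

  module _ {i : Fin k} (matched : ∀ {j : Fin k} → j Fin.< i → FJobsMatched j) where

    holder-of-earlier : ∀ {z p} → FJobBelow H C (toℕ i) p → Holds M z p → category z Fin.< i
    holder-of-earlier b h with fJobBelow⇒ b
    ... | j , j<i , fj with matched j<i _ fj
    ...   | x , refl , _ , h′ with injective h h′
    ...     | refl = j<i

    -- Earlier f-jobs are held from earlier categories, so a job held by `x` is among those of which
    -- `p` is the first.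
    f-improves : ∀ {x p} → category x ≡ i → IsF H C x p → ¬ Holds M x p → Improves M x p
    f-improves refl isF = first-improves strict M isF
      (λ h b → ℕ.<-irrefl refl (holder-of-earlier b h))

    not-held-from-earlier : ∀ {p y} → FJob H C i p → Holds M y p → ¬ category y Fin.< i
    not-held-from-earlier {p} {y} (x , refl , isF) h y<x =
      chain (proj₁ isF) (f-improves refl isF x-unheld) h
        (λ b → let _ , j<y , fj = fJobBelow⇒ b in
               proj₁ (proj₂ isF) (fJobBelow⇐ (ℕ.<-trans j<y y<x) fj))
        (λ isFy → proj₁ (proj₂ isF) (fJobBelow⇐ y<x (y , refl , isFy)))
        (f-holder-category (matched y<x))
      where
      x-unheld : ¬ Holds M x p
      x-unheld h′ = ℕ.<-irrefl (cong (toℕ ∘ category) (injective h h′)) y<x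

    matched-step : FJobsMatched i
    matched-step p fj@(x , refl , isF) with Fin.any? (λ y → holds? M y p)
    ... | no free = ⊥-elim (promote {M = M} popular (proj₁ isF)
            (f-improves refl isF (λ h → free (x , h)))
            (λ h → contradiction (_ , h) free))
    ... | yes (y , h) with Fin.<-cmp (category y) i
    ...   | tri< y<x _ _ = contradiction y<x (not-held-from-earlier fj h)
    -- A holder from a later category is lighter than `x`, so the single exchange suffices.
    ...   | tri> _ _ x<y = ⊥-elim (promote {M = M} popular (proj₁ isF)
              (f-improves refl isF (λ h′ → ℕ.<-irrefl (cong (toℕ ∘ category) (injective h′ h)) x<y))
              (λ h′ → subst (λ z → weight z W.< weight x) (injective h h′) (weight-decreasing x<y)))
    ...   | tri≈ _ y≡x _ with isF? y p
    ...     | yes isFy = y , y≡x , isFy , h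
    ...     | no ¬isFy = ⊥-elim (chain (proj₁ isF)
                (f-improves refl isF (λ h′ → ¬isFy (subst (λ z → IsF H C z p) (injective h′ h) isF)))
                h (subst (λ j → ¬ FJobBelow H C (toℕ j) p) (sym y≡x) (proj₁ (proj₂ isF))) ¬isFy
                -- The induction hypothesis stops before `i`, but `f(y)` is itself an f-job of
                -- category `i`, so it too is not held from an earlier category.
                (λ {q} {z} isFq hz → subst (Fin._≤ category z) (sym y≡x)
                   (ℕ.≮⇒≥ (not-held-from-earlier (y , y≡x , isFq) hz))))

  fJobsMatched : ∀ i → FJobsMatched i
  fJobsMatched = All.wfRec <-wellFounded _ FJobsMatched (λ _ → matched-step)

  -- Every applicant holds its first or second job.

  AvailableForS : Applicant → Job → Set
  AvailableForS x q = ∀ j → j Fin.≤ category x → ¬ FJob H C j q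

  availableForS? : ∀ x → Decidable (AvailableForS x)
  availableForS? x q = Fin.all? (λ j → j Fin.≤? category x →-dec ¬? (fJob? j q))

  -- An f-job of any category is held by an applicant whose first job it is; by injectivity that
  -- applicant would be `x`.
  held-f-or-availableForS : ∀ {x p} → Holds M x p → ¬ IsF H C x p → AvailableForS x p
  held-f-or-availableForS {x} {p} h ¬isF j j≤x fj with fJobsMatched j p fj
  ... | y , refl , isFy , h′ with injective h h′
  ...   | refl = ¬isF isFy

  -- An unmatched `x` could take `l x`, which no other applicant can hold.
  applicant-matched : ∀ x → ∃ (Holds M x)
  applicant-matched x with partner x in eq
  ... | just p  = p , refl
  ... | nothing = ⊥-elim (promote {M = M} popular (l-on-list x)
    (subst (Prefers H x (just (l x))) (sym eq) over-unmatched)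
    (λ h → contradiction
      (trans (sym eq) (subst (λ z → Holds M z (l x)) (l-exclusive (on-list h)) h)) λ ()))

  -- Otherwise `x` prefers `q = s(x)`. The double exchange excludes a holder of `q` from the same or
  -- an earlier category, so `q` is free or held by someone lighter, and the single exchange
  -- applies.
  held-f-or-s : ∀ {x p} → Holds M x p → IsF H C x p ⊎ IsS H C x p
  held-f-or-s {x} {p} h with isF? x p
  ... | yes isF = inj₁ isF
  ... | no ¬isF with isFirst? (availableForS? x) x p
  ...   | yes isS = inj₂ isS
  -- The job that `x` holds witnesses that `s(x)` exists.
  ...   | no ¬isS with first-exists (availableForS? x) (on-list h) (held-f-or-availableForS h ¬isF)
  ...     | q , isS@(q∈ , q-available , _) = ⊥-elim (promote {M = M} popular q∈ better light)
    where
    better : Improves M x q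
    better = first-improves strict M isS
      (λ h′ → subst (AvailableForS x) (Maybe.just-injective (trans (sym h) h′))
                (held-f-or-availableForS h ¬isF))
      (λ h′ → ¬isS (subst (IsS H C x) (Maybe.just-injective (trans (sym h′) h)) isS))

    not-from-earlier : ∀ {y} → Holds M y q → ¬ category y Fin.≤ category x
    not-from-earlier {y} hy y≤x = chain q∈ better hy
      (λ b → let j , j<y , fj = fJobBelow⇒ b in
             q-available j (ℕ.≤-trans (ℕ.<⇒≤ j<y) y≤x) fj)
      (λ isFy → q-available (category y) y≤x (y , refl , isFy))
      (f-holder-category (fJobsMatched (category y)))

    light : ∀ {y} → Holds M y q → weight y W.< weight x
    light hy = weight-decreasing (ℕ.≰⇒> (not-from-earlier hy))

theorem1 : ∀ {c ℓ₁ ℓ₂} (W : OrderedAbelianGroup c ℓ₁ ℓ₂) (H : Instance W) →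
    Strict H → LastResorts H → (C : Categories H) →
    (M : Matching H) → Popular H M → WellFormed H C M
theorem1 W H strict lastResorts C M popular =
  fJobsMatched , λ x → let p , h = applicant-matched x in p , held-f-or-s h , h
  where open PopularMatchings H strict lastResorts C M popular
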